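{- Let $\langle\mathfrak{B},\Diamond\rangle$ be an S5 modal algebra, and let $\mathsf{C}_{\diamond}=\{\langle x,y\rangle\in B\times B\mid x\cdot\Diamond y\neq\mathbf{0}\}$. Then the expansion $\langle\mathfrak{B},\Diamond,\mathsf{C}_{\diamond}\rangle$ can be embedded into a modal expansion of a resolution algebra; that is, there are a resolution contact algebra $\langle\mathfrak{A},\mathsf{C}_P\rangle$, with its associated modal operator $m\colon A\to A$, and an injective Boolean homomorphism $e\colon B\to A$ such that $e(\Diamond x)=m(e(x))$ and $x\mathrel{\mathsf{C}_{\diamond}}y\iff e(x)\mathrel{\mathsf{C}_P}e(y)$ for all $x,y\in B$.
   Context: A modal algebra is a Boolean algebra $\mathfrak{B}=\langle B,\cdot,+,-,\mathbf{0},\mathbf{1}\rangle$ with an operator $\Diamond\colon B\to B$ satisfying $\Diamond\mathbf{0}=\mathbf{0}$ and $\Diamond(x+y)=\Diamond x+\Diamond y$ for all $x,y\in B$. It is an S5 algebra if moreover, for all $x\in B$: $x\leq\Diamond x$, $\Diamond\Box x\leq x$ (where $\Box x=-\Diamond(-x)$) and $\Diamond\Diamond x\leq\Diamond x$. A partition of a Boolean algebra $\mathfrak{A}$ (with domain $A$) is a non-empty set $P$ of non-zero, pairwise disjoint elements of $A$ with $\bigvee P=\mathbf{1}$. For a complete Boolean algebra $\mathfrak{A}$ and a partition $P$ of it, put $x\mathrel{\mathsf{C}_P}y\iff(\exists p\in P)(x\cdot p\neq\mathbf{0}\text{ and }y\cdot p\neq\mathbf{0})$; the pair $\langle\mathfrak{A},\mathsf{C}_P\rangle$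 is called a resolution contact algebra (resolution algebra). Its modal operator $m\colon A\to A$ assigns to $x$ the unique $y\in A$ with $\{z\in A\mid z\mathrel{\mathsf{C}_P}x\}=\{z\in A\mid z\cdot y\neq\mathbf{0}\}$; equivalently $m(x)=\bigvee\{p\in P\mid x\cdot p\neq\mathbf{0}\}$. Its modal expansion is $\langle\mathfrak{A},m,\mathsf{C}_P\rangle$. -}

module Defs where

open import Level using (Level; Setω; _⊔_; suc)
open import Algebra.Core using (Op₁)
open import Algebra.Definitions using (Congruent₁)
open import Algebra.Lattice.Bundles using (BooleanAlgebra)
import Algebra.Lattice.Properties.BooleanAlgebra as BooleanAlgebraProperties
open import Algebra.Lattice.Morphism.Structures using (IsLatticeMonomorphism)
open import Axiom.ExcludedMiddle using (ExcludedMiddle)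
open import Axiom.Extensionality.Propositional using (Extensionality)
open import Data.Product using (∃; ∃-syntax; _×_)
open import Function.Bundles using (_⇔_)
open import Relation.Binary.Bundles using (Poset)
open import Relation.Binary.Core using (Rel)
open import Relation.Binary.Definitions using (_Respects_)
open import Relation.Unary using (Pred; _∈_; Satisfiable)

private
  variable
    a b c ℓ ℓ₁ ℓ₂ r₁ r₂ : Level

-- The ambient classical set theory, as explicit assumptions. Excluded middle
-- here applies to all types, not only to propositions, so it also selects an
-- element of every non-empty type; with function extensionality, extensionally
-- equal Boolean-valued predicates are given the same selected element, which
-- yields the axiom of choice. Some choice is unavoidable when embedding S5
-- algebras into resolution algebras: taking ◇ to be the identity, such
-- embeddings give the Boolean prime ideal theorem.

record ClassicalLogicWithChoice : Setω where
  field
    excludedMiddle : ∀ {ℓ : Level} → ExcludedMiddle ℓ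
    extensionality : ∀ {a b : Level} → Extensionality a b

record ModalAlgebra (c ℓ : Level) : Set (suc (c ⊔ ℓ)) where
  field
    booleanAlgebra : BooleanAlgebra c ℓ

  open BooleanAlgebra booleanAlgebra public

  field
    ◇      : Op₁ Carrier
    ◇-cong : Congruent₁ _≈_ ◇
    ◇-⊥    : ◇ ⊥ ≈ ⊥
    ◇-∨    : ∀ x y → ◇ (x ∨ y) ≈ ◇ x ∨ ◇ y

  □ : Op₁ Carrier
  □ x = ¬ (◇ (¬ x))

record S5Algebra (c ℓ : Level) : Set (suc (c ⊔ ℓ)) where
  field
    modalAlgebra : ModalAlgebra c ℓ

  open ModalAlgebra modalAlgebra public
  open Poset (BooleanAlgebraProperties.poset booleanAlgebra) public using (_≤_)

  field
    x≤◇x   : ∀ x → x ≤ ◇ x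
    ◇□x≤x  : ∀ x → ◇ (□ x) ≤ x
    ◇◇x≤◇x : ∀ x → ◇ (◇ x) ≤ ◇ x

module _ (𝔄 : BooleanAlgebra a ℓ) where
  open BooleanAlgebra 𝔄
  open Poset (BooleanAlgebraProperties.poset 𝔄) using (_≤_)

  record IsSupremum {p} (S : Pred Carrier p) (s : Carrier) : Set (a ⊔ ℓ ⊔ p) where
    field
      upperBound : ∀ {x} → x ∈ S → x ≤ s
      least      : ∀ {u} → (∀ {x} → x ∈ S → x ≤ u) → s ≤ u

  -- S need not respect _≈_; it has the same upper bounds as its closure
  -- under _≈_.
  Complete : Set (suc (a ⊔ ℓ))
  Complete = (S : Pred Carrier (a ⊔ ℓ)) → ∃ (IsSupremum S)

  record IsPartition {p} (P : Pred Carrier p) : Set (a ⊔ ℓ ⊔ p) where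
    field
      respects : P Respects _≈_
      nonEmpty : Satisfiable P
      nonZero  : ∀ {x} → x ∈ P → x ≉ ⊥
      disjoint : ∀ {x y} → x ∈ P → y ∈ P → x ≉ y → x ∧ y ≈ ⊥
      join     : IsSupremum P ⊤

record ResolutionAlgebra (a ℓ : Level) : Set (suc (a ⊔ ℓ)) where
  field
    booleanAlgebra : BooleanAlgebra a ℓ

  open BooleanAlgebra booleanAlgebra public

  field
    complete    : Complete booleanAlgebra
    P           : Pred Carrier (a ⊔ ℓ)
    isPartition : IsPartition booleanAlgebra P

  infix 4 _C_

  _C_ : Rel Carrier (a ⊔ ℓ)
  x C y = ∃[ p ] (p ∈ P × x ∧ p ≉ ⊥ × y ∧ p ≉ ⊥)

  Represents : Carrier → Carrier → Set (a ⊔ ℓ)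
  Represents x y = ∀ z → (z C x) ⇔ (z ∧ y ≉ ⊥)

  IsModalOperator : Op₁ Carrier → Set (a ⊔ ℓ)
  IsModalOperator m = ∀ x →
    Represents x (m x) × (∀ y → Represents x y → m x ≈ y)

record Expansion (a ℓ r : Level) : Set (suc (a ⊔ ℓ ⊔ r)) where
  field
    booleanAlgebra : BooleanAlgebra a ℓ

  open BooleanAlgebra booleanAlgebra public

  field
    operator : Op₁ Carrier
    relation : Rel Carrier r

S5-expansion : S5Algebra c ℓ → Expansion c ℓ ℓ
S5-expansion 𝔅 = record
  { booleanAlgebra = booleanAlgebra
  ; operator       = ◇
  ; relation       = λ x y → x ∧ ◇ y ≉ ⊥
  }
  where open S5Algebra 𝔅

resolutionExpansion : (𝔄 : ResolutionAlgebra a ℓ) →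
                      Op₁ (ResolutionAlgebra.Carrier 𝔄) →
                      Expansion a ℓ (a ⊔ ℓ)
resolutionExpansion 𝔄 m = record
  { booleanAlgebra = booleanAlgebra
  ; operator       = m
  ; relation       = _C_
  }
  where open ResolutionAlgebra 𝔄

record IsEmbedding (𝔅 : Expansion b ℓ₁ r₁) (𝔄 : Expansion a ℓ₂ r₂)
                   (e : Expansion.Carrier 𝔅 → Expansion.Carrier 𝔄)
                   : Set (a ⊔ b ⊔ ℓ₁ ⊔ ℓ₂ ⊔ r₁ ⊔ r₂) where
  private
    module B = Expansion 𝔅
    module A = Expansion 𝔄

  field
    isLatticeMonomorphism : IsLatticeMonomorphism B.rawLattice A.rawLattice e
    ⊤-homo                : e B.⊤ A.≈ A.⊤
    ⊥-homo                : e B.⊥ A.≈ A.⊥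
    ¬-homo                : ∀ x → e (B.¬ x) A.≈ A.¬ (e x)
    operator-homo         : ∀ x → e (B.operator x) A.≈ A.operator (e x)
    relation-⇔            : ∀ x y → B.relation x y ⇔ A.relation (e x) (e y)

{-# OPTIONS --safe #-}
module Submission where

open import Defs
open import Level using (Level; _⊔_)
open import Algebra.Core using (Op₁)
open import Algebra.Lattice.Bundles using (BooleanAlgebra)
import Algebra.Lattice.Properties.BooleanAlgebra as BooleanAlgebraProperties
open import Data.Bool using (Bool; true; false; T; not; _∧_; _∨_)
import Data.Bool.Properties as Bool
open import Data.Empty using (⊥-elim)
open import Data.Product
  using (∃; ∃-syntax; Σ-syntax; _×_; _,_; proj₁; proj₂; uncurry)
open import Data.Sum using (_⊎_; inj₁; inj₂)
open import Data.Unit using (tt)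
open import Function using (_∘_; id; mk⇔; Equivalence)
open import Relation.Binary.Core using (Rel)
open import Relation.Binary.Structures using (IsEquivalence)
import Relation.Binary.Lattice as Order
open import Relation.Binary.PropositionalEquality
  using (_≡_; refl; sym; trans; cong; cong₂; subst)
open import Relation.Nullary using (¬_; Dec; yes; no; contradiction)
open import Relation.Nullary.Decidable
  using (isYes; toWitness; fromWitness; decidable-stable)
open import Relation.Unary using (Pred)

open Equivalence using (to; from)

private
  variable
    a b c g ℓ p r : Level
    A : Set a

-- Embedding 𝔅 into the powerset of its set X of ultrafilters (the Stone map),
-- let u ~ v mean that u and v contain the same elements ◇ x. The classes of ~
-- partition X, and m f is the ~-saturation of f. If ◇ x ∈ u, then x together
-- with the closed elements of u (those d with ◇ d ≤ d) generates a proper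
-- filter, because complements of closed elements are closed in S5; any
-- ultrafilter above it contains x and is ~-related to u. This gives
-- e (◇ x) = m (e x).

-- Subsets as Boolean-valued functions.

T-ext : ∀ {x y} → (T x → T y) → (T y → T x) → x ≡ y
T-ext {false} {false} f g = refl
T-ext {false} {true}  f g = ⊥-elim (g tt)
T-ext {true}  {false} f g = ⊥-elim (f tt)
T-ext {true}  {true}  f g = refl

¬T⇒T-not : ∀ {x} → ¬ T x → T (not x)
¬T⇒T-not {false} ¬x = tt
¬T⇒T-not {true}  ¬x = ⊥-elim (¬x tt)

T-not⇒¬T : ∀ {x} → T (not x) → ¬ T x
T-not⇒¬T {false} _ x = x

infix 4 _⊆_

_⊆_ : Rel (A → Bool) _
F ⊆ G = ∀ x → T (F x) → T (G x)

module Classical (classical : ClassicalLogicWithChoice) where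

  open ClassicalLogicWithChoice classical
    renaming (excludedMiddle to em; extensionality to ext)

  ⊆-antisym : {F G : A → Bool} → F ⊆ G → G ⊆ F → F ≡ G
  ⊆-antisym F⊆G G⊆F = ext λ x → T-ext (F⊆G x) (G⊆F x)

  -- Excluded middle at level `p` turns a predicate of any level into a subset whose type stays at
  -- the level of `A`. This makes impredicative definitions of subsets possible.
  char : Pred A p → A → Bool
  char P x = isYes (em {P = P x})

  char⁺ : (P : Pred A p) {x : A} → P x → T (char P x)
  char⁺ P = fromWitness

  char⁻ : (P : Pred A p) {x : A} → T (char P x) → P x
  char⁻ P = toWitness

  Union : Pred (A → Bool) p → Pred A _
  Union C x = ∃[ F ] (C F × T (F x))

  ⋃ : Pred (A → Bool) p → A → Bool
  ⋃ C = char (Union C)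

  -- Zorn's lemma for families of subsets.

  IsChain : Pred (A → Bool) p → Set _
  IsChain C = ∀ {F G} → C F → C G → F ⊆ G ⊎ G ⊆ F

  -- The stages are the sets F_α = F₀ ∪ ⋃_{β<α} next (F_β) of the transfinite
  -- iteration of next, indexed by the sets themselves instead of ordinals.

  module Zorn {B : Set b} (Good : Pred (B → Bool) g)
    (good-⋃ : (C : Pred (B → Bool) b) → ∃ C → (∀ {F} → C F → Good F) →
              IsChain C → Good (⋃ C))
    {F₀ : B → Bool} (good-F₀ : Good F₀) where

    GoodExtension : Rel (B → Bool) _
    GoodExtension F G = Good G × F ⊆ G × ¬ (G ⊆ F)

    extendBy : ∀ F → Dec (∃ (GoodExtension F)) → B → Bool
    extendBy F (yes (G , _)) = G
    extendBy F (no _)        = F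

    -- Applied to the type of proper good extensions, `em` returns one of them if there is any, so
    -- it acts as a choice function.
    next : (B → Bool) → B → Bool
    next F = extendBy F em

    next-good : ∀ {F} → Good F → Good (next F)
    next-good {F} good with em {P = ∃ (GoodExtension F)}
    ... | yes (_ , good′ , _) = good′
    ... | no _                = good

    next-inflationary : ∀ F → F ⊆ next F
    next-inflationary F with em {P = ∃ (GoodExtension F)}
    ... | yes (_ , _ , F⊆G , _) = F⊆G
    ... | no _                  = λ _ → id

    -- If `F` had a proper good extension, `next F` would be one and could not be contained in `F`.
    fixed⇒maximal : ∀ {F G} → next F ⊆ F → Good G → F ⊆ G → G ⊆ F
    fixed⇒maximal {F} {G} fixed good F⊆G with em {P = ∃ (GoodExtension F)}
    ... | yes (_ , _ , _ , H⊈F) = contradiction fixed H⊈F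
    ... | no ¬ext = decidable-stable em λ G⊈F → ¬ext (G , good , F⊆G , G⊈F)

    -- The disjunct `G ≡ F₀` keeps the family inhabited even for empty `S`, as `good-⋃` demands, and
    -- puts `F₀` inside every stage.
    Successors : (S : (B → Bool) → Bool) → Pred (B → Bool) b
    Successors S G = G ≡ F₀ ⊎ ∃[ F ] (T (S F) × G ≡ next F)

    -- Taking `S` Boolean-valued keeps this type at level `b`, so that `char Stage` is itself an
    -- admissible `S`.
    data Stage : Pred (B → Bool) b where
      stage : ∀ S → (∀ F → T (S F) → Stage F) → Stage (⋃ (Successors S))

    next⊆⋃ : ∀ S {F} → T (S F) → next F ⊆ ⋃ (Successors S)
    next⊆⋃ S F∈S x x∈ =
      char⁺ (Union (Successors S)) (_ , inj₂ (_ , F∈S , refl) , x∈)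

    F₀⊆stage : ∀ {F} → Stage F → F₀ ⊆ F
    F₀⊆stage (stage S _) x x∈ =
      char⁺ (Union (Successors S)) (F₀ , inj₁ refl , x∈)

    ⋃⊆ : ∀ S {F} → Stage F → (∀ {G} → T (S G) → next G ⊆ F) →
         ⋃ (Successors S) ⊆ F
    ⋃⊆ S sF next⊆F x x∈ with char⁻ (Union (Successors S)) x∈
    ... | _ , inj₁ refl , x∈F₀               = F₀⊆stage sF x x∈F₀
    ... | _ , inj₂ (_ , G∈S , refl) , x∈next = next⊆F G∈S x x∈next

    -- Induction on the stages. Either all `next G` with `G` in `S` lie in `F`, and so does their
    -- union, or some `next G` does not. For that `G`, the recursive call with swapped arguments
    -- gives `F ⊆ G`, and a second call decides between `next F ⊆ G` and `F ≡ G`; both put `next F`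
    -- inside the union.
    compare : ∀ {F G} → Stage F → Stage G → next F ⊆ G ⊎ G ⊆ F
    compare {F} sF (stage S h)
      with em {P = ∃[ G ] (T (S G) × ¬ (next G ⊆ F))}
    ... | no ¬∃ = inj₂ (⋃⊆ S sF λ G∈S →
      decidable-stable em λ next⊈F → ¬∃ (_ , G∈S , next⊈F))
    ... | yes (G , G∈S , next⊈F) with compare (h G G∈S) sF
    ...   | inj₁ next⊆F = contradiction next⊆F next⊈F
    ...   | inj₂ F⊆G with compare sF (h G G∈S)
    ...     | inj₁ next⊆G = inj₁ λ x x∈ →
      next⊆⋃ S G∈S x (next-inflationary G x (next⊆G x x∈))
    -- Here next F = next G only because next depends on F as a function;
    -- this is where extensionality turns excluded middle into choice.
    ...     | inj₂ G⊆F = inj₁ (subst (λ H → next H ⊆ ⋃ (Successors S))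
      (⊆-antisym G⊆F F⊆G) (next⊆⋃ S G∈S))

    next-chain : ∀ {F G} → Stage F → Stage G →
                 next F ⊆ next G ⊎ next G ⊆ next F
    next-chain {F} {G} sF sG with compare sF sG | compare sG sF
    ... | inj₁ next⊆G | _           =
      inj₁ λ x x∈ → next-inflationary G x (next⊆G x x∈)
    ... | inj₂ _      | inj₁ next⊆F =
      inj₂ λ x x∈ → next-inflationary F x (next⊆F x x∈)
    ... | inj₂ G⊆F    | inj₂ F⊆G    =
      inj₁ (subst (λ H → next F ⊆ next H) (⊆-antisym F⊆G G⊆F) λ _ → id)

    F₀⊆next : ∀ {F} → Stage F → F₀ ⊆ next F
    F₀⊆next {F} sF x x∈ = next-inflationary F x (F₀⊆stage sF x x∈)

    successors-chain : ∀ S → (∀ F → T (S F) → Stage F) →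
                       IsChain (Successors S)
    successors-chain S h (inj₁ refl) (inj₁ refl) = inj₁ λ _ → id
    successors-chain S h (inj₁ refl) (inj₂ (G , G∈S , refl)) =
      inj₁ (F₀⊆next (h G G∈S))
    successors-chain S h (inj₂ (F , F∈S , refl)) (inj₁ refl) =
      inj₂ (F₀⊆next (h F F∈S))
    successors-chain S h (inj₂ (F , F∈S , refl)) (inj₂ (G , G∈S , refl)) =
      next-chain (h F F∈S) (h G G∈S)

    stage-good : ∀ {F} → Stage F → Good F
    stage-good (stage S h) = good-⋃ (Successors S) (F₀ , inj₁ refl)
      (λ { (inj₁ refl)             → good-F₀
         ; (inj₂ (F , F∈S , refl)) → next-good (stage-good (h F F∈S)) })
      (successors-chain S h)

    -- The union over all stages is again a stage, so it contains its own successor and is a fixed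
    -- point of `next`.
    top : B → Bool
    top = ⋃ (Successors (char Stage))

    top-stage : Stage top
    top-stage = stage (char Stage) λ _ → char⁻ Stage

    zorn : ∃[ M ] (F₀ ⊆ M × Good M × (∀ {G} → Good G → M ⊆ G → G ⊆ M))
    zorn = top , F₀⊆stage top-stage , stage-good top-stage ,
      fixed⇒maximal (next⊆⋃ (char Stage) (char⁺ Stage top-stage))

  -- Filters, ultrafilters and the ultrafilter theorem.

  module Ultrafilters (𝔅 : BooleanAlgebra c ℓ) where

    open BooleanAlgebra 𝔅
      renaming (_∧_ to _⊓_; _∨_ to _⊔ᴮ_; ¬_ to ∁_)
      hiding (refl; sym; trans)
    open BooleanAlgebraProperties 𝔅
      using (∧-identityʳ; ∧-zeroʳ; ∨-identityˡ; ¬-involutive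
            ; ∨-∧-orderTheoreticLattice)
    open Order.Lattice ∨-∧-orderTheoreticLattice
      using (_≤_; antisym; x≤x∨y; y≤x∨y; ∨-least; x∧y≤x; x∧y≤y; ∧-greatest)
      renaming (refl to ≤-refl; trans to ≤-trans; reflexive to ≤-reflexive)
      public
    module ≈ = BooleanAlgebra 𝔅
    open import Relation.Binary.Reasoning.Setoid setoid

    ⊓-mono : ∀ {w x y z} → w ≤ x → y ≤ z → w ⊓ y ≤ x ⊓ z
    ⊓-mono w≤x y≤z = ∧-greatest (≤-trans (x∧y≤x _ _) w≤x)
                                (≤-trans (x∧y≤y _ _) y≤z)

    ⊥-minimum : ∀ x → ⊥ ≤ x
    ⊥-minimum x = ≤-trans (≤-reflexive (≈.sym (∧-zeroʳ x))) (x∧y≤x _ _)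

    ⊤-maximum : ∀ x → x ≤ ⊤
    ⊤-maximum x = ≈.sym (∧-identityʳ x)

    ≤⊥⇒≈⊥ : ∀ {x} → x ≤ ⊥ → x ≈ ⊥
    ≤⊥⇒≈⊥ x≤⊥ = antisym x≤⊥ (⊥-minimum _)

    disjoint⇒≤∁ : ∀ {x y} → x ⊓ y ≈ ⊥ → y ≤ ∁ x
    disjoint⇒≤∁ {x} {y} x⊓y≈⊥ = begin
      y                       ≈⟨ ∧-identityʳ y ⟨
      y ⊓ ⊤                   ≈⟨ ∧-congˡ (∨-complementʳ x) ⟨
      y ⊓ (x ⊔ᴮ ∁ x)          ≈⟨ ∧-distribˡ-∨ y x (∁ x) ⟩
      (y ⊓ x) ⊔ᴮ (y ⊓ ∁ x)    ≈⟨ ∨-congʳ (≈.trans (∧-comm y x) x⊓y≈⊥) ⟩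
      ⊥ ⊔ᴮ (y ⊓ ∁ x)          ≈⟨ ∨-identityˡ _ ⟩
      y ⊓ ∁ x                 ∎

    disjoint-∁⇒≤ : ∀ {x y} → x ⊓ ∁ y ≈ ⊥ → x ≤ y
    disjoint-∁⇒≤ {x} {y} eq = ≤-trans
      (disjoint⇒≤∁ (≈.trans (∧-comm (∁ y) x) eq)) (≤-reflexive (¬-involutive y))

    record IsProperFilter (F : Carrier → Bool) : Set (c ⊔ ℓ) where
      field
        upward   : ∀ {x y} → x ≤ y → T (F x) → T (F y)
        ⊓-closed : ∀ {x y} → T (F x) → T (F y) → T (F (x ⊓ y))
        ⊤∈       : T (F ⊤)
        ⊥∉       : ¬ T (F ⊥)

    -- The chain condition serves closure under meets: two elements of the union both lie in the
    -- larger of their two filters.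
    properFilter-⋃ : (C : Pred (Carrier → Bool) p) → ∃ C →
                     (∀ {F} → C F → IsProperFilter F) →
                     IsChain C → IsProperFilter (⋃ C)
    properFilter-⋃ C (F₀ , F₀∈C) filters chain = record
      { upward   = λ x≤y x∈ → let F , F∈C , x∈F = char⁻ U x∈ in
          char⁺ U (F , F∈C , upward (filters F∈C) x≤y x∈F)
      ; ⊓-closed = λ x∈ y∈ → meet (char⁻ U x∈) (char⁻ U y∈)
      ; ⊤∈       = char⁺ U (F₀ , F₀∈C , ⊤∈ (filters F₀∈C))
      ; ⊥∉       = λ ⊥∈ → let F , F∈C , ⊥∈F = char⁻ U ⊥∈ in
          ⊥∉ (filters F∈C) ⊥∈F
      }
      where
      open IsProperFilter
      U = Union C

      meet : ∀ {x y} → U x → U y → T (⋃ C (x ⊓ y))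
      meet (F , F∈C , x∈F) (G , G∈C , y∈G) with chain F∈C G∈C
      ... | inj₁ F⊆G =
        char⁺ U (G , G∈C , ⊓-closed (filters G∈C) (F⊆G _ x∈F) y∈G)
      ... | inj₂ G⊆F =
        char⁺ U (F , F∈C , ⊓-closed (filters F∈C) x∈F (G⊆F _ y∈G))

    -- When `D` contains `⊤` and is closed under meets, this is the filter generated by `D` and `a`.
    Generated : Pred Carrier p → Carrier → Pred Carrier _
    Generated D a x = ∃[ d ] (D d × a ⊓ d ≤ x)

    generated-isProperFilter :
      (D : Pred Carrier p) → D ⊤ → (∀ {d e} → D d → D e → D (d ⊓ e)) →
      ∀ {a} → (∀ {d} → D d → a ⊓ d ≉ ⊥) →
      IsProperFilter (char (Generated D a))
    generated-isProperFilter D ⊤∈D ⊓∈D {a} meets = record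
      { upward   = λ x≤y x∈ → let d , d∈D , ad≤x = char⁻ Gen x∈ in
          char⁺ Gen (d , d∈D , ≤-trans ad≤x x≤y)
      ; ⊓-closed = λ x∈ y∈ →
          let d , d∈D , ad≤x = char⁻ Gen x∈
              e , e∈D , ae≤y = char⁻ Gen y∈
          in char⁺ Gen (d ⊓ e , ⊓∈D d∈D e∈D , ∧-greatest
               (≤-trans (⊓-mono ≤-refl (x∧y≤x d e)) ad≤x)
               (≤-trans (⊓-mono ≤-refl (x∧y≤y d e)) ae≤y))
      ; ⊤∈       = char⁺ Gen (⊤ , ⊤∈D , ⊤-maximum _)
      ; ⊥∉       = λ ⊥∈ → let d , d∈D , ad≤⊥ = char⁻ Gen ⊥∈ in
          meets d∈D (≤⊥⇒≈⊥ ad≤⊥)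
      }
      where Gen = Generated D a

    record Ultrafilter : Set (c ⊔ ℓ) where
      field
        member         : Carrier → Bool
        isProperFilter : IsProperFilter member
        prime          : ∀ x → ¬ T (member x) → T (member (∁ x))

      open IsProperFilter isProperFilter public

      member-cong : ∀ {x y} → x ≈ y → member x ≡ member y
      member-cong x≈y = T-ext (upward (≤-reflexive x≈y))
                              (upward (≤-reflexive (≈.sym x≈y)))

      member-⊤ : member ⊤ ≡ true
      member-⊤ = to Bool.T-≡ ⊤∈

      member-⊥ : member ⊥ ≡ false
      member-⊥ = to Bool.T-not-≡ (¬T⇒T-not ⊥∉)

      member-⊓ : ∀ x y → member (x ⊓ y) ≡ member x ∧ member y
      member-⊓ x y = T-ext
        (λ xy → from Bool.T-∧ (upward (x∧y≤x x y) xy , upward (x∧y≤y x y) xy))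
        (uncurry ⊓-closed ∘ to Bool.T-∧)

      ∁∈⇒∉ : ∀ {x} → T (member (∁ x)) → ¬ T (member x)
      ∁∈⇒∉ ∁x∈ x∈ = ⊥∉ (upward (≤-reflexive (∧-complementʳ _)) (⊓-closed x∈ ∁x∈))

      member-∁ : ∀ x → member (∁ x) ≡ not (member x)
      member-∁ x = T-ext (¬T⇒T-not ∘ ∁∈⇒∉) (prime x ∘ T-not⇒¬T)

      ∨∈⇒∈ : ∀ x y → T (member (x ⊔ᴮ y)) → T (member x) ⊎ T (member y)
      ∨∈⇒∈ x y xy∈ with em {P = T (member x)}
      ... | yes x∈ = inj₁ x∈
      ... | no x∉  = inj₂ (upward ≤y (⊓-closed (prime x x∉) xy∈))
        where
        ≤y : ∁ x ⊓ (x ⊔ᴮ y) ≤ y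
        ≤y = ≤-trans (≤-reflexive (∧-distribˡ-∨ (∁ x) x y))
          (∨-least (≤-trans (≤-reflexive (∧-complementˡ x)) (⊥-minimum y))
                   (x∧y≤y (∁ x) y))

      member-∨ : ∀ x y → member (x ⊔ᴮ y) ≡ member x ∨ member y
      member-∨ x y = T-ext (from Bool.T-∨ ∘ ∨∈⇒∈ x y) (join ∘ to Bool.T-∨)
        where
        join : T (member x) ⊎ T (member y) → T (member (x ⊔ᴮ y))
        join (inj₁ x∈) = upward (x≤x∨y x y) x∈
        join (inj₂ y∈) = upward (y≤x∨y x y) y∈

    open Ultrafilter using (member)

    -- A maximal proper filter `M` is prime: if `x` is disjoint from some `d` in `M`, then
    -- `d ≤ ∁ x`; otherwise `M` and `x` generate a proper filter, and maximality puts `x` in `M`.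
    ultrafilter-extension : ∀ {F} → IsProperFilter F →
                            ∃[ u ] (F ⊆ member u)
    ultrafilter-extension {F} filter = record
      { member         = M
      ; isProperFilter = M-filter
      ; prime          = prime
      } , F⊆M
      where
      M,props = Zorn.zorn IsProperFilter properFilter-⋃ filter
      M        = proj₁ M,props
      F⊆M      = proj₁ (proj₂ M,props)
      M-filter = proj₁ (proj₂ (proj₂ M,props))
      maximal  = proj₂ (proj₂ (proj₂ M,props))
      open IsProperFilter M-filter

      prime : ∀ x → ¬ T (M x) → T (M (∁ x))
      prime x x∉ with em {P = ∃[ d ] (T (M d) × x ⊓ d ≈ ⊥)}
      ... | yes (d , d∈ , xd≈⊥) = upward (disjoint⇒≤∁ xd≈⊥) d∈
      ... | no ¬∃ = contradiction (maximal generated M⊆ x x∈) x∉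
        where
        Gen = Generated (T ∘ M) x

        generated : IsProperFilter (char Gen)
        generated = generated-isProperFilter (T ∘ M) ⊤∈ ⊓-closed
          λ d∈ xd≈⊥ → ¬∃ (_ , d∈ , xd≈⊥)

        M⊆ : M ⊆ char Gen
        M⊆ d d∈ = char⁺ Gen (d , d∈ , x∧y≤y x d)

        x∈ : T (char Gen x)
        x∈ = char⁺ Gen (⊤ , ⊤∈ , x∧y≤x x ⊤)

    -- The family `D` is kept general to serve two purposes: a trivial `D` yields separation of
    -- elements, and the closed elements of an ultrafilter yield a related ultrafilter.
    ultrafilter-through :
      (D : Pred Carrier p) → D ⊤ → (∀ {d e} → D d → D e → D (d ⊓ e)) →
      ∀ {a} → (∀ {d} → D d → a ⊓ d ≉ ⊥) →
      ∃[ u ] (T (member u a) × (∀ {d} → D d → T (member u d)))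
    ultrafilter-through D ⊤∈D ⊓∈D {a} meets =
      let u , Gen⊆u = ultrafilter-extension
            (generated-isProperFilter D ⊤∈D ⊓∈D meets)
      in u , Gen⊆u a (char⁺ (Generated D a) (⊤ , ⊤∈D , x∧y≤x a ⊤))
           , λ {d} d∈D → Gen⊆u d
               (char⁺ (Generated D a) (d , d∈D , x∧y≤y a d))

    ≉⊥⇒∈ultrafilter : ∀ {a} → a ≉ ⊥ → ∃[ u ] T (member u a)
    ≉⊥⇒∈ultrafilter {a} a≉⊥ =
      -- With `D` consisting of `⊤` alone, the condition on meets says just that `a` is nonzero.
      let u , a∈u , _ = ultrafilter-through (_≈ ⊤) ≈.refl
            (λ d≈⊤ e≈⊤ → ≈.trans (∧-cong d≈⊤ e≈⊤) (∧-identityʳ ⊤))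
            (λ d≈⊤ ad≈⊥ → a≉⊥ (≈.trans (≈.sym (∧-identityʳ a))
              (≈.trans (∧-congˡ (≈.sym d≈⊤)) ad≈⊥)))
      in u , a∈u

    -- If `x ⊓ ∁ y` were nonzero, an ultrafilter through it would contain `x` but not `y`. This
    -- yields injectivity of the Stone map.
    ⊆ultrafilters⇒≤ : ∀ {x y} →
      (∀ u → T (member u x) → T (member u y)) → x ≤ y
    ⊆ultrafilters⇒≤ {x} {y} x⊆y = disjoint-∁⇒≤ (decidable-stable em λ xy′≉⊥ →
      let u , xy′∈u = ≉⊥⇒∈ultrafilter xy′≉⊥
          open Ultrafilter u
      in ∁∈⇒∉ (upward (x∧y≤y x (∁ y)) xy′∈u)
              (x⊆y u (upward (x∧y≤x x (∁ y)) xy′∈u)))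

  -- Powerset algebras and their completeness.

  powerset : Set a → BooleanAlgebra a a
  powerset X = record
    { Carrier          = X → Bool
    ; _≈_              = λ f g → ∀ x → f x ≡ g x
    ; _∨_              = λ f g x → f x ∨ g x
    ; _∧_              = λ f g x → f x ∧ g x
    ; ¬_               = λ f x → not (f x)
    ; ⊤                = λ _ → true
    ; ⊥                = λ _ → false
    ; isBooleanAlgebra = record
      { isDistributiveLattice = record
        { isLattice = record
          { isEquivalence = record
            { refl  = λ _ → refl
            ; sym   = λ f≈g x → sym (f≈g x)
            ; trans = λ f≈g g≈h x → trans (f≈g x) (g≈h x)
            }
          ; ∨-comm     = λ f g x → Bool.∨-comm (f x) (g x)
          ; ∨-assoc    = λ f g h x → Bool.∨-assoc (f x) (g x) (h x)
          ; ∨-cong     = λ f≈g h≈k x → cong₂ _∨_ (f≈g x) (h≈k x)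
          ; ∧-comm     = λ f g x → Bool.∧-comm (f x) (g x)
          ; ∧-assoc    = λ f g h x → Bool.∧-assoc (f x) (g x) (h x)
          ; ∧-cong     = λ f≈g h≈k x → cong₂ _∧_ (f≈g x) (h≈k x)
          ; absorptive = (λ f g x → proj₁ Bool.∨-∧-absorptive (f x) (g x))
                       , (λ f g x → proj₂ Bool.∨-∧-absorptive (f x) (g x))
          }
        ; ∨-distrib-∧ = (λ f g h x → Bool.∨-distribˡ-∧ (f x) (g x) (h x))
                      , (λ f g h x → Bool.∨-distribʳ-∧ (f x) (g x) (h x))
        ; ∧-distrib-∨ = (λ f g h x → Bool.∧-distribˡ-∨ (f x) (g x) (h x))
                      , (λ f g h x → Bool.∧-distribʳ-∨ (f x) (g x) (h x))
        }
      ; ∨-complement = (λ f x → Bool.∨-inverseˡ (f x))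
                     , (λ f x → Bool.∨-inverseʳ (f x))
      ; ∧-complement = (λ f x → Bool.∧-inverseˡ (f x))
                     , (λ f x → Bool.∧-inverseʳ (f x))
      ; ¬-cong       = λ f≈g x → cong not (f≈g x)
      }
    }

  module Powerset (X : Set a) where

    open BooleanAlgebra (powerset X) using (_≈_; _≉_; ⊥) renaming (_∧_ to _∩_)
    open Order.Lattice (BooleanAlgebraProperties.∨-∧-orderTheoreticLattice (powerset X))
      using (_≤_)

    ⊆⇒≤ : ∀ {f g : X → Bool} → f ⊆ g → f ≤ g
    ⊆⇒≤ f⊆g x = T-ext (λ fx → from Bool.T-∧ (fx , f⊆g x fx))
                      (proj₁ ∘ to Bool.T-∧)

    ≤⇒⊆ : ∀ {f g : X → Bool} → f ≤ g → f ⊆ g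
    ≤⇒⊆ f≤g x fx = proj₂ (to Bool.T-∧ (subst T (f≤g x) fx))

    inhabited⇒≉⊥ : ∀ {f : X → Bool} {x} → T (f x) → f ≉ ⊥
    inhabited⇒≉⊥ {x = x} fx f≈⊥ = subst T (f≈⊥ x) fx

    ≉⊥⇒inhabited : ∀ {f : X → Bool} → f ≉ ⊥ → ∃[ x ] T (f x)
    ≉⊥⇒inhabited f≉⊥ = decidable-stable em λ ¬∃ →
      f≉⊥ λ x → T-ext (λ fx → ¬∃ (x , fx)) ⊥-elim

    overlap⇒≉⊥ : ∀ (f g : X → Bool) {x} → T (f x) → T (g x) → f ∩ g ≉ ⊥
    overlap⇒≉⊥ f g fx gx = inhabited⇒≉⊥ (from Bool.T-∧ (fx , gx))

    ≉⊥⇒overlap : ∀ (f g : X → Bool) → f ∩ g ≉ ⊥ → ∃[ x ] (T (f x) × T (g x))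
    ≉⊥⇒overlap f g fg≉⊥ = let x , fgx = ≉⊥⇒inhabited fg≉⊥ in x , to Bool.T-∧ fgx

    complete : Complete (powerset X)
    complete S = ⋃ S , record
      { upperBound = λ {f} f∈S → ⊆⇒≤ λ x fx → char⁺ (Union S) (f , f∈S , fx)
      ; least      = λ f≤u → ⊆⇒≤ λ x x∈ →
          let f , f∈S , fx = char⁻ (Union S) x∈ in ≤⇒⊆ (f≤u f∈S) x fx
      }

  -- The resolution algebra of an equivalence relation.

  module EquivalencePartition {X : Set a} (x₀ : X)
    {_~_ : Rel X r} (isEquivalence : IsEquivalence _~_) where

    open Powerset X
    module ~ = IsEquivalence isEquivalence
    open BooleanAlgebra (powerset X) using (_≈_)
      renaming (¬_ to ∁_)

    class : X → X → Bool
    class x = char (x ~_)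

    class⁻ : ∀ {p x y} → p ≈ class x → T (p y) → x ~ y
    class⁻ {x = x} {y} p≈ py = char⁻ (x ~_) (subst T (p≈ y) py)

    class⁺ : ∀ {p x y} → p ≈ class x → x ~ y → T (p y)
    class⁺ {x = x} {y} p≈ x~y = subst T (sym (p≈ y)) (char⁺ (x ~_) x~y)

    -- Membership up to pointwise equality makes the partition respect `_≈_`. Since `class` goes
    -- through `char`, the level `r` of `_~_` does not appear.
    Class : Pred (X → Bool) a
    Class p = ∃[ x ] (p ≈ class x)

    class-∈ : ∀ x → Class (class x)
    class-∈ x = x , λ _ → refl

    classes-isPartition : IsPartition (powerset X) Class
    classes-isPartition = record
      { respects = λ f≈g (x , f≈) → x , λ y → trans (sym (f≈g y)) (f≈ y)
      ; nonEmpty = class x₀ , class-∈ x₀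
      ; nonZero  = λ (x , p≈) → inhabited⇒≉⊥ (class⁺ p≈ ~.refl)
      ; disjoint = λ {p} {q} (x , p≈) (y , q≈) p≉q →
          decidable-stable em λ pq≉⊥ →
            -- A common point `z` relates the two representatives, so the classes coincide.
            let z , pz , qz = ≉⊥⇒overlap p q pq≉⊥
                x~y = ~.trans (class⁻ p≈ pz) (~.sym (class⁻ q≈ qz))
            in p≉q λ w → T-ext
                 (λ pw → class⁺ q≈ (~.trans (~.sym x~y) (class⁻ p≈ pw)))
                 (λ qw → class⁺ p≈ (~.trans x~y (class⁻ q≈ qw)))
      ; join     = record
        { upperBound = λ _ → ⊆⇒≤ λ _ _ → tt
        ; least      = λ p≤u → ⊆⇒≤ λ x _ →
            ≤⇒⊆ (p≤u (class-∈ x)) x (char⁺ (x ~_) ~.refl)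
        }
      }

    resolutionAlgebra : ResolutionAlgebra a a
    resolutionAlgebra = record
      { booleanAlgebra = powerset X
      ; complete       = complete
      ; P              = Class
      ; isPartition    = classes-isPartition
      }

    open ResolutionAlgebra resolutionAlgebra
      using (Represents; IsModalOperator)

    Saturation : (X → Bool) → Pred X _
    Saturation f x = ∃[ y ] (x ~ y × T (f y))

    saturate : (X → Bool) → X → Bool
    saturate f = char (Saturation f)

    -- A class meeting both `z` and `f` supplies related points `v` of `z` and `w` of `f`;
    -- conversely, for such points the class of `v` meets both.
    saturate-represents : ∀ f → Represents f (saturate f)
    saturate-represents f z = mk⇔
      (λ (p , (x , p≈) , zp≉⊥ , fp≉⊥) →
        let v , zv , pv = ≉⊥⇒overlap z p zp≉⊥
            w , fw , pw = ≉⊥⇒overlap f p fp≉⊥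
        in overlap⇒≉⊥ z (saturate f) zv (char⁺ (Saturation f)
             (w , ~.trans (~.sym (class⁻ p≈ pv)) (class⁻ p≈ pw) , fw)))
      (λ zm≉⊥ →
        let v , zv , v∈m = ≉⊥⇒overlap z (saturate f) zm≉⊥
            w , v~w , fw = char⁻ (Saturation f) v∈m
        in class v , class-∈ v
           , overlap⇒≉⊥ z (class v) zv (char⁺ (v ~_) ~.refl)
           , overlap⇒≉⊥ f (class v) fw (char⁺ (v ~_) v~w))

    -- The test element is `∁ h`: a point of `g` outside `h` would put `∁ h` in contact with `f`, so
    -- `∁ h` would meet `h`. Applied both ways, this gives uniqueness of the modal operator.
    representation-⊆ : ∀ {f g h} → Represents f g → Represents f h → g ⊆ h
    representation-⊆ {f} {g} {h} rg rh x gx = decidable-stable em λ ¬hx →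
      let v , h′v , hv = ≉⊥⇒overlap (∁ h) h (to (rh (∁ h)) (from (rg (∁ h))
            (overlap⇒≉⊥ (∁ h) g (¬T⇒T-not ¬hx) gx)))
      in T-not⇒¬T h′v hv

    saturate-isModalOperator : IsModalOperator saturate
    saturate-isModalOperator f = saturate-represents f , λ g rg x → T-ext
      (representation-⊆ {f} (saturate-represents f) rg x)
      (representation-⊆ {f} rg (saturate-represents f) x)

  -- The Stone map of an S5 algebra.

  module S5Representation (𝔅 : S5Algebra c ℓ)
    (⊥≉⊤ : S5Algebra._≉_ 𝔅 (S5Algebra.⊥ 𝔅) (S5Algebra.⊤ 𝔅)) where

    open S5Algebra 𝔅
      using (Carrier; booleanAlgebra; _≈_; _≉_; ⊥; ⊤; ∧-comm; ¬-cong
            ; ◇; ◇-cong; ◇-∨; x≤◇x; ◇□x≤x; ◇◇x≤◇x)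
      renaming (_∧_ to _⊓_; ¬_ to ∁_)
    open BooleanAlgebraProperties booleanAlgebra
      using (¬-involutive)
    open Ultrafilters booleanAlgebra
    open Ultrafilter using (member)

    ◇-mono : ∀ {x y} → x ≤ y → ◇ x ≤ ◇ y
    ◇-mono {x} {y} x≤y = ≤-trans (x≤x∨y (◇ x) (◇ y)) (≤-reflexive
      (≈.trans (≈.sym (◇-∨ x y))
               (◇-cong (antisym (∨-least x≤y ≤-refl) (y≤x∨y x y)))))

    -- By `x≤◇x` these are the fixed points of `◇`, and by `◇◇x≤◇x` every `◇ y` is among them.
    Closed : Pred Carrier ℓ
    Closed x = ◇ x ≤ x

    closed-⊓ : ∀ {x y} → Closed x → Closed y → Closed (x ⊓ y)
    closed-⊓ {x} {y} ◇x≤x ◇y≤y = ∧-greatest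
      (≤-trans (◇-mono (x∧y≤x x y)) ◇x≤x)
      (≤-trans (◇-mono (x∧y≤y x y)) ◇y≤y)

    -- For closed `x`, `◇ x ≈ x` gives `∁ x ≈ □ (∁ x)`, and `◇□x≤x` at `∁ x` finishes.
    closed-∁ : ∀ {x} → Closed x → Closed (∁ x)
    closed-∁ {x} ◇x≤x =
      ≤-trans (◇-mono (≤-reflexive ∁x≈□∁x)) (◇□x≤x (∁ x))
      where
      ∁x≈□∁x : ∁ x ≈ ∁ (◇ (∁ (∁ x)))
      ∁x≈□∁x = ¬-cong (≈.trans (antisym (x≤◇x x) ◇x≤x)
                               (◇-cong (≈.sym (¬-involutive x))))

    -- Nontriviality of the algebra enters here: a partition must have a member, so some ultrafilter
    -- must exist.
    point : Ultrafilter
    point = proj₁ (≉⊥⇒∈ultrafilter (⊥≉⊤ ∘ ≈.sym))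

    -- In S5 this is the canonical accessibility relation, written in a form that is visibly an
    -- equivalence.
    _~_ : Rel Ultrafilter _
    u ~ v = ∀ x → member u (◇ x) ≡ member v (◇ x)

    ~-isEquivalence : IsEquivalence _~_
    ~-isEquivalence = record
      { refl  = λ _ → refl
      ; sym   = λ u~v x → sym (u~v x)
      ; trans = λ u~v v~w x → trans (u~v x) (v~w x)
      }

    ◇∈⇒∃~ : ∀ u {x} → T (member u (◇ x)) →
            ∃[ v ] (u ~ v × T (member v x))
    ◇∈⇒∃~ u {x} ◇x∈u =
      let v , x∈v , D⊆v = ultrafilter-through D
            (⊤-maximum (◇ ⊤) , ⊤∈)
            (λ (cd , d∈) (ce , e∈) → closed-⊓ cd ce , ⊓-closed d∈ e∈)
            meets
      in v , (λ y → T-ext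
           (λ ◇y∈u → D⊆v (◇◇x≤◇x y , ◇y∈u))
           -- If `◇ y` were not in `u`, its complement, again closed, would be in `D` and hence in
           -- `v`.
           (λ ◇y∈v → decidable-stable em λ ◇y∉u →
             Ultrafilter.∁∈⇒∉ v
               (D⊆v (closed-∁ (◇◇x≤◇x y) , prime (◇ y) ◇y∉u)) ◇y∈v))
         , x∈v
      where
      open Ultrafilter u hiding (member)

      D : Pred Carrier _
      D d = Closed d × T (member u d)

      meets : ∀ {d} → D d → x ⊓ d ≉ ⊥
      -- Disjointness gives `x ≤ ∁ d`, hence `◇ x ≤ ◇ (∁ d) ≤ ∁ d`, which would put `∁ d` in `u`
      -- beside `d`.
      meets {d} (closed , d∈u) xd≈⊥ = ∁∈⇒∉
        (upward (≤-trans
          (◇-mono (disjoint⇒≤∁ (≈.trans (∧-comm d x) xd≈⊥)))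
          (closed-∁ closed)) ◇x∈u)
        d∈u

    open EquivalencePartition point ~-isEquivalence
    open Powerset Ultrafilter using (inhabited⇒≉⊥; ≉⊥⇒inhabited)

    stone : Carrier → Ultrafilter → Bool
    stone x u = member u x

    -- One inclusion is `◇∈⇒∃~`. For the other, `x` in `v` gives `◇ x` in `v` by `x≤◇x`, and `u ~ v`
    -- carries it over to `u`.
    stone-◇ : ∀ x u → stone (◇ x) u ≡ saturate (stone x) u
    stone-◇ x u = T-ext (char⁺ (Saturation (stone x)) {u} ∘ ◇∈⇒∃~ u) λ u∈ →
      let v , u~v , x∈v = char⁻ (Saturation (stone x)) {u} u∈
      in subst T (sym (u~v x)) (Ultrafilter.upward v (x≤◇x x) x∈v)

    stone-meet-saturate : ∀ x y u →
      stone (x ⊓ ◇ y) u ≡ stone x u ∧ saturate (stone y) u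
    stone-meet-saturate x y u = trans (Ultrafilter.member-⊓ u x (◇ y))
      (cong (stone x u ∧_) (stone-◇ y u))

    stone-isEmbedding :
      IsEmbedding (S5-expansion 𝔅)
                  (resolutionExpansion resolutionAlgebra saturate) stone
    stone-isEmbedding = record
      { isLatticeMonomorphism = record
        { isLatticeHomomorphism = record
          { isRelHomomorphism = record
            { cong = λ x≈y u → Ultrafilter.member-cong u x≈y }
          ; ∧-homo = λ x y u → Ultrafilter.member-⊓ u x y
          ; ∨-homo = λ x y u → Ultrafilter.member-∨ u x y
          }
        ; injective = λ eq → antisym
            (⊆ultrafilters⇒≤ λ u → subst T (eq u))
            (⊆ultrafilters⇒≤ λ u → subst T (sym (eq u)))
        }
      ; ⊤-homo        = Ultrafilter.member-⊤
      ; ⊥-homo        = Ultrafilter.member-⊥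
      ; ¬-homo        = λ x u → Ultrafilter.member-∁ u x
      ; operator-homo = stone-◇
      ; relation-⇔    = λ x y →
          -- Through `rep`, contact of the images means that the image of `x ⊓ ◇ y` is inhabited,
          -- and an element is nonzero exactly when some ultrafilter contains it.
          let rep = saturate-represents (stone y) (stone x) in mk⇔
          (λ x◇y≉⊥ → from rep
            let u , u∈ = ≉⊥⇒∈ultrafilter x◇y≉⊥
            in inhabited⇒≉⊥ {x = u} (subst T (stone-meet-saturate x y u) u∈))
          (λ xCy x◇y≈⊥ →
            let u , u∈ = ≉⊥⇒inhabited (to rep xCy)
                open Ultrafilter u
            in ⊥∉ (upward (≤-reflexive x◇y≈⊥)
                 (subst T (sym (stone-meet-saturate x y u)) u∈)))
      }

theorem7p5 : ClassicalLogicWithChoice →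
    ∀ {c ℓ} (𝔅 : S5Algebra c ℓ) →
    S5Algebra._≉_ 𝔅 (S5Algebra.⊥ 𝔅) (S5Algebra.⊤ 𝔅) →
    Σ[ 𝔄 ∈ ResolutionAlgebra (c ⊔ ℓ) (c ⊔ ℓ) ]
    Σ[ m ∈ Op₁ (ResolutionAlgebra.Carrier 𝔄) ]
    Σ[ e ∈ (S5Algebra.Carrier 𝔅 → ResolutionAlgebra.Carrier 𝔄) ]
    (ResolutionAlgebra.IsModalOperator 𝔄 m ×
    IsEmbedding (S5-expansion 𝔅) (resolutionExpansion 𝔄 m) e)
theorem7p5 classical 𝔅 ⊥≉⊤ =
  resolutionAlgebra , saturate , stone ,
  saturate-isModalOperator , stone-isEmbedding
  where
  open Classical classical
  open S5Representation 𝔅 ⊥≉⊤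
  open EquivalencePartition point ~-isEquivalence
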